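{- Let $m,n\ge 2$ and $\lambda_2\ge 1$ be integers. Suppose there exists an affine resolvable semi-regular group divisible (ARSRGD) design with $m$ groups of size $n$ and parameters $$v=b=mn,\quad r=k=m,\quad \lambda_1=0,\quad \lambda_2.$$ Then there exists a full pairwise additive BIB design (full PAB) with parameters $$v^\ast=m=n\lambda_2,\quad b^\ast=(m-1)n,\quad r^\ast=m-1,\quad k^\ast=\lambda_2,\quad \lambda^\ast=\lambda_2-1.$$
   Context: Block designs. A block design BD$(v,b,r,k)$ consists of a set $V$ of $v$ points and a family (repetitions allowed) of $b$ blocks, each block being a set of $k$ different points, such that each point lies in exactly $r$ blocks. Its incidence matrix is the $v\times b$ $(0,1)$-matrix whose $(i,j)$ entry is $1$ if and only if the $i$-th point lies in the $j$-th block. A BD$(v,b,r,k)$ is a balanced incomplete block (BIB) design BIBD$(v,b,r,k,\lambda)$ if any two different points lie together in exactly $\lambda$ blocks. (The degenerate cases $k=1$, $\lambda=0$ and $k=v$ are allowed.) Pairwise additive BIB designs. A PAB$(\ell;v,k,\lambda)$, with associated $b$ and $r$, is a set of $\ell$ matrices $N_1,\dots,N_\ell$ of size $v\times b$, $N_h=(a^{(h)}_{ij})$, such that each $N_h$ is the incidence matrix of a BIBD$(v,b,r,k,\lambda)$, $a^{(h_1)}_{ij}a^{(h_2)}_{ij}=0$ for all $i,j$ and all distinct $h_1,h_2$, and for all distinct $h_1,h_2$ the matrix $N_{h_1}+N_{h_2}$ is the incidence matrix of a BIBD with parameters $(v,\,b,\,2r,\,2k,\,2r(2k-1)/(v-1))$.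 A full PAB with parameters $v,b,r,k,\lambda$ is a PAB$(\ell;v,k,\lambda)$ (with these $b$ and $r$) for which $\ell=v/k$. Group divisible designs. A BD$(v,b,r,k)$ with $v=mn$ is a group divisible design with parameters $\lambda_1,\lambda_2$ if the points are partitioned into $m$ groups of $n$ points such that any two different points in the same group lie together in exactly $\lambda_1$ blocks and any two points from different groups lie together in exactly $\lambda_2$ blocks. It is semi-regular if $r-\lambda_1>0$ and $rk-v\lambda_2=0$. A BD$(v,b,r,k)$ is resolvable if its $b$ blocks can be partitioned into $r$ resolution sets of $b/r=v/k$ blocks each such that every point occurs exactly once in each resolution set. A resolvable design is affine resolvable if, for such a partition, every two blocks belonging to different resolution sets intersect in the same number $q$ of points, where for a group divisible design $q=k\lambda_2/r$. An ARSRGD design is a semi-regular group divisible design that is affine resolvable. -}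

module Defs where

open import Data.Bool.Base using (if_then_else_)
open import Data.Fin.Base using (Fin)
open import Data.Fin.Properties using (_≟_)
open import Data.Fin.Subset using (Subset; _∩_; ∣_∣)
open import Data.Fin.Subset.Properties using (_∈?_)
open import Data.Nat.Base using (ℕ; _+_; _*_; _∸_; _<_)
open import Data.Product.Base using (∃-syntax; _×_)
open import Data.Vec.Base using (tabulate)
open import Relation.Binary.PropositionalEquality.Core using (_≡_; _≢_)
open import Relation.Nullary.Decidable.Core using (does)
open import Relation.Nullary.Negation.Core using (¬_)

-- The points are the elements of Fin v.  Blocks are indexed by Fin b, so
-- the same subset may occur as a block several times.
Blocks : ℕ → ℕ → Set
Blocks v b = Fin b → Subset v

blocksThrough : ∀ {v b} → Blocks v b → Fin v → Subset b
blocksThrough B p = tabulate λ j → does (p ∈? B j)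

fibre : ∀ {n m} → (Fin n → Fin m) → Fin m → Subset n
fibre f y = tabulate λ x → does (f x ≟ y)

jointBlocks : ∀ {v b} → Blocks v b → Fin v → Fin v → ℕ
jointBlocks B p p′ = ∣ blocksThrough B p ∩ blocksThrough B p′ ∣

record IsBD (v b r k : ℕ) (B : Blocks v b) : Set where
  field
    blockSize   : ∀ j → ∣ B j ∣ ≡ k
    replication : ∀ p → ∣ blocksThrough B p ∣ ≡ r

record IsBIBD (v b r k ƛ : ℕ) (B : Blocks v b) : Set where
  field
    isBD    : IsBD v b r k B
    balance : ∀ p p′ → p ≢ p′ → jointBlocks B p p′ ≡ ƛ

Matrix : ℕ → ℕ → Set
Matrix v b = Fin v → Fin b → ℕ

_≐_ : ∀ {v b} → Matrix v b → Matrix v b → Set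
M ≐ N = ∀ i j → M i j ≡ N i j

_⊕_ : ∀ {v b} → Matrix v b → Matrix v b → Matrix v b
(M ⊕ N) i j = M i j + N i j

incidence : ∀ {v b} → Blocks v b → Matrix v b
incidence B i j = if does (i ∈? B j) then 1 else 0

IsBIBDMatrix : (v b r k ƛ : ℕ) → Matrix v b → Set
IsBIBDMatrix v b r k ƛ M = ∃[ B ] IsBIBD v b r k ƛ B × M ≐ incidence B

record IsPAB (ℓ v b r k ƛ : ℕ) (N : Fin ℓ → Matrix v b) : Set where
  field
    -- Makes the quotient 2r(2k-1)/(v-1) in sumBIBD meaningful.
    1<v      : 1 < v
    -- The matrices form a set of ℓ elements.
    distinct : ∀ h h′ → h ≢ h′ → ¬ (N h ≐ N h′)
    isBIBD   : ∀ h → IsBIBDMatrix v b r k ƛ (N h)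
    disjoint : ∀ h h′ → h ≢ h′ → ∀ i j → N h i j * N h′ i j ≡ 0
    -- μ = 2r(2k-1)/(v-1), which is thereby an exact quotient.
    sumBIBD  : ∀ h h′ → h ≢ h′ →
               ∃[ μ ] μ * (v ∸ 1) ≡ 2 * r * (2 * k ∸ 1)
                    × IsBIBDMatrix v b (2 * r) (2 * k) μ (N h ⊕ N h′)

record FullPAB (v b r k ƛ : ℕ) : Set where
  field
    ℓ        : ℕ
    matrices : Fin ℓ → Matrix v b
    isPAB    : IsPAB ℓ v b r k ƛ matrices
    -- Together: ℓ = v/k, an exact quotient with nonzero divisor.
    0<k      : 0 < k
    ℓ*k≡v    : ℓ * k ≡ v

record IsGroupDivisible (m n v b r k λ₁ λ₂ : ℕ) (B : Blocks v b) : Set where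
  field
    isBD           : IsBD v b r k B
    v≡m*n          : v ≡ m * n
    group          : Fin v → Fin m
    groupSize      : ∀ g → ∣ fibre group g ∣ ≡ n
    sameGroup      : ∀ p p′ → p ≢ p′ → group p ≡ group p′ →
                     jointBlocks B p p′ ≡ λ₁
    differentGroup : ∀ p p′ → group p ≢ group p′ →
                     jointBlocks B p p′ ≡ λ₂

record IsSemiRegular (v r k λ₁ λ₂ : ℕ) : Set where
  field
    λ₁<r      : λ₁ < r
    r*k≡v*λ₂ : r * k ≡ v * λ₂

record IsResolution (v b r k : ℕ) (B : Blocks v b) (res : Fin b → Fin r) : Set where
  field
    -- Each resolution set consists of b/r = v/k blocks.
    size*r≡b : ∀ t → ∣ fibre res t ∣ * r ≡ b
    size*k≡v : ∀ t → ∣ fibre res t ∣ * k ≡ v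
    once     : ∀ t p → ∣ blocksThrough B p ∩ fibre res t ∣ ≡ 1

record IsAffineResolvable (v b r k q : ℕ) (B : Blocks v b) : Set where
  field
    res          : Fin b → Fin r
    isResolution : IsResolution v b r k B res
    affine       : ∀ j j′ → res j ≢ res j′ → ∣ B j ∩ B j′ ∣ ≡ q

record ARSRGD (m n v b r k λ₁ λ₂ : ℕ) : Set where
  field
    blocks             : Blocks v b
    isGroupDivisible   : IsGroupDivisible m n v b r k λ₁ λ₂ blocks
    isSemiRegular      : IsSemiRegular v r k λ₁ λ₂
    q                  : ℕ
    -- q = kλ₂/r.
    q*r≡k*λ₂          : q * r ≡ k * λ₂
    isAffineResolvable : IsAffineResolvable v b r k q blocks

{-# OPTIONS --safe #-}
module Submission where

-- Fix one resolution set, with blocks C₁, …, Cₙ, and let D range over the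
-- (m − 1)n remaining blocks.  Since λ₁ = 0 and k = m, every block is a
-- transversal of the m groups, so the points of each C_h can be indexed by the
-- groups.  The matrix N_h records which points of C_h lie on which blocks D.  Its
-- columns sum to |C_h ∩ D| = λ₂; two points of C_h share λ₂ blocks, one of them
-- C_h itself; and points of C_h and C_h′ in different groups share λ₂ blocks, all
-- of them among the D.

open import Defs
open import Data.Bool.Base using (true; false; if_then_else_)
open import Data.Fin.Base using (Fin; zero; suc)
open import Data.Fin.Properties using (_≟_; 0≢1+n; suc-injective)
open import Data.Fin.Subset using (Subset; _∈_; _∉_; _∩_; ∁; ∣_∣; inside; outside)
open import Data.Fin.Subset.Properties
  using (_∈?_; ∣∁p∣≡n∸∣p∣; x∈p∩q⁺; x∈p∩q⁻; x∈∁p⇒x∉p)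
open import Data.Nat.Base using (ℕ; zero; suc; _+_; _*_; _∸_; _≤_; z≤n; s≤s)
open import Data.Nat.Properties as ℕ
  using (+-*-semiring; +-identityʳ; *-identityʳ; *-identityˡ; *-comm; *-assoc; *-distribʳ-+;
         *-cancelʳ-≡; *-cancelˡ-≡; +-cancelˡ-≡; m+n∸m≡n; ≤-refl; ≤-antisym; +-mono-≤; +-monoʳ-≤;
         +-cancelʳ-≤; m+n≡0⇒m≡0; m+n≡0⇒n≡0; m*n≡0⇒m≡0∨n≡0; 1+n≢0; module ≤-Reasoning)
open import Data.Nat.Tactic.RingSolver using (solve-∀)
open import Algebra.Properties.Semiring.Sum +-*-semiring
  using (sum; sum-cong-≗; ∑-distrib-+; ∑-comm; *-distribˡ-sum)
open import Data.Product.Base using (∃-syntax; _×_; _,_; proj₁; proj₂)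
open import Data.Vec.Base using ([]; _∷_; here; there; tabulate)
open import Data.Sum.Base using ([_,_]′)
open import Function.Base using (id; _∘_)
open import Relation.Binary.PropositionalEquality
  using (_≡_; _≢_; refl; sym; trans; cong; cong₂; subst; module ≡-Reasoning)
open import Relation.Nullary.Decidable.Core using (Dec; does; yes; no)
open import Relation.Nullary.Negation.Core using (¬_; contradiction)

private
  variable
    b k m n r v ƛ : ℕ

-- Indicator functions of subsets.

𝟙 : Subset n → Fin n → ℕ
𝟙 S x = if does (x ∈? S) then 1 else 0

𝟙≤1 : (S : Subset n) (x : Fin n) → 𝟙 S x ≤ 1
𝟙≤1 S x with x ∈? S
... | yes _ = ≤-refl
... | no  _ = z≤n

𝟙-∈ : {S : Subset n} {x : Fin n} → x ∈ S → 𝟙 S x ≡ 1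
𝟙-∈ {S = S} {x} x∈S with x ∈? S
... | yes _   = refl
... | no  x∉S = contradiction x∈S x∉S

𝟙-∉ : {S : Subset n} {x : Fin n} → x ∉ S → 𝟙 S x ≡ 0
𝟙-∉ {S = S} {x} x∉S with x ∈? S
... | yes x∈S = contradiction x∈S x∉S
... | no  _   = refl

𝟙-∩ : (S T : Subset n) (x : Fin n) → 𝟙 (S ∩ T) x ≡ 𝟙 S x * 𝟙 T x
𝟙-∩ (inside  ∷ S) (inside  ∷ T) zero = refl
𝟙-∩ (inside  ∷ S) (outside ∷ T) zero = refl
𝟙-∩ (outside ∷ S) (_       ∷ T) zero = refl
𝟙-∩ (_ ∷ S) (_ ∷ T) (suc x) = 𝟙-∩ S T x

𝟙-∁ : (S : Subset n) (x : Fin n) → 𝟙 S x + 𝟙 (∁ S) x ≡ 1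
𝟙-∁ (inside  ∷ S) zero = refl
𝟙-∁ (outside ∷ S) zero = refl
𝟙-∁ (_ ∷ S) (suc x) = 𝟙-∁ S x

𝟙-tabulate : {P : Fin n → Set} (P? : ∀ x → Dec (P x)) (x : Fin n) →
             𝟙 (tabulate (does ∘ P?)) x ≡ (if does (P? x) then 1 else 0)
𝟙-tabulate P? zero with does (P? zero)
... | true = refl
... | false = refl
𝟙-tabulate P? (suc x) = 𝟙-tabulate (P? ∘ suc) x

∈-tabulate⁺ : {P : Fin n → Set} (P? : ∀ x → Dec (P x)) {x : Fin n} →
              P x → x ∈ tabulate (does ∘ P?)
∈-tabulate⁺ P? {zero} px with P? zero
... | yes _  = here
... | no ¬px = contradiction px ¬px
∈-tabulate⁺ P? {suc x} px = there (∈-tabulate⁺ (P? ∘ suc) px)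

∈-tabulate⁻ : {P : Fin n → Set} (P? : ∀ x → Dec (P x)) {x : Fin n} →
              x ∈ tabulate (does ∘ P?) → P x
∈-tabulate⁻ P? {zero} x∈ with P? zero
... | yes px = px
∈-tabulate⁻ P? {suc x} (there x∈) = ∈-tabulate⁻ (P? ∘ suc) x∈

-- Finite sums of natural numbers.

sum-𝟙 : (S : Subset n) → sum (𝟙 S) ≡ ∣ S ∣
sum-𝟙 []            = refl
sum-𝟙 (inside  ∷ S) = cong suc (sum-𝟙 S)
sum-𝟙 (outside ∷ S) = sum-𝟙 S

sum-𝟙*𝟙 : (S T : Subset n) → sum (λ x → 𝟙 S x * 𝟙 T x) ≡ ∣ S ∩ T ∣
sum-𝟙*𝟙 S T = trans (sum-cong-≗ (sym ∘ 𝟙-∩ S T)) (sum-𝟙 (S ∩ T))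

sum-*1 : (f : Fin n → ℕ) → sum (λ i → f i * 1) ≡ sum f
sum-*1 f = sum-cong-≗ λ i → *-identityʳ (f i)

sum-0 : sum {n} (λ _ → 0) ≡ 0
sum-0 {n} = sym (*-distribˡ-sum {n} 0 (λ _ → 0))

sum≡0⇒≡0 : (f : Fin n → ℕ) → sum f ≡ 0 → ∀ i → f i ≡ 0
sum≡0⇒≡0 f eq zero    = m+n≡0⇒m≡0 (f zero) eq
sum≡0⇒≡0 f eq (suc i) = sum≡0⇒≡0 (f ∘ suc) (m+n≡0⇒n≡0 (f zero) eq) i

sum≤n : (f : Fin n → ℕ) → (∀ i → f i ≤ 1) → sum f ≤ n
sum≤n {zero}  _ _   = z≤n
sum≤n {suc n} f f≤1 = +-mono-≤ (f≤1 zero) (sum≤n (f ∘ suc) (f≤1 ∘ suc))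

-- With `n` terms of size at most 1, a total of `n` leaves no slack in any term. This later turns
-- the bound of one point per group into equality.
sum≡n⇒≡1 : (f : Fin n → ℕ) → (∀ i → f i ≤ 1) → sum f ≡ n → ∀ i → f i ≡ 1
sum≡n⇒≡1 {suc n} f f≤1 eq = λ where
    zero    → f0≡1
    (suc i) → sum≡n⇒≡1 (f ∘ suc) (f≤1 ∘ suc)
                (+-cancelˡ-≡ 1 _ _ (trans (cong (_+ sum (f ∘ suc)) (sym f0≡1)) eq)) i
  where
  f0≡1 : f zero ≡ 1
  f0≡1 = ≤-antisym (f≤1 zero) (+-cancelʳ-≤ n 1 (f zero) (begin
    suc n                  ≡⟨ eq ⟨
    f zero + sum (f ∘ suc) ≤⟨ +-monoʳ-≤ (f zero) (sum≤n (f ∘ suc) (f≤1 ∘ suc)) ⟩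
    f zero + n             ∎))
    where open ≤-Reasoning

sum-split : (S : Subset n) (f : Fin n → ℕ) →
            sum f ≡ sum (λ x → 𝟙 S x * f x) + sum (λ x → 𝟙 (∁ S) x * f x)
sum-split S f = trans
  (sum-cong-≗ λ x → trans (sym (*-identityˡ (f x)))
    (trans (cong (_* f x) (sym (𝟙-∁ S x))) (*-distribʳ-+ (f x) (𝟙 S x) (𝟙 (∁ S) x))))
  (∑-distrib-+ (λ x → 𝟙 S x * f x) (λ x → 𝟙 (∁ S) x * f x))

-- Enumerations of subsets.

record Enumeration (S : Subset n) (k : ℕ) : Set where
  field
    at     : Fin k → Fin n
    at∈    : ∀ i → at i ∈ S
    inj    : ∀ i j → at i ≡ at j → i ≡ j
    surj   : ∀ {x} → x ∈ S → ∃[ i ] at i ≡ x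
    sum-at : ∀ f → sum (f ∘ at) ≡ sum (λ x → 𝟙 S x * f x)

open Enumeration

enumerate : (S : Subset n) → Enumeration S ∣ S ∣
enumerate [] = record
  { at = λ () ; at∈ = λ () ; inj = λ () ; surj = λ () ; sum-at = λ _ → refl }
enumerate (outside ∷ S) = record
  { at     = suc ∘ at E
  ; at∈    = there ∘ at∈ E
  ; inj    = λ i j → inj E i j ∘ suc-injective
  ; surj   = λ { (there x∈S) → let i , eq = surj E x∈S in i , cong suc eq }
  ; sum-at = λ f → sum-at E (f ∘ suc)
  }
  where E = enumerate S
enumerate (inside ∷ S) = record
  { at     = λ { zero → zero ; (suc i) → suc (at E i) }
  ; at∈    = λ { zero → here ; (suc i) → there (at∈ E i) }
  ; inj    = λ where
      zero    zero    _  → refl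
      zero    (suc j) ()
      (suc i) zero    ()
      (suc i) (suc j) eq → cong suc (inj E i j (suc-injective eq))
  ; surj   = λ where
      here        → zero , refl
      (there x∈S) → let i , eq = surj E x∈S in suc i , cong suc eq
  ; sum-at = λ f → cong₂ _+_ (sym (*-identityˡ (f zero))) (sum-at E (f ∘ suc))
  }
  where E = enumerate S

-- Matching on the equation replaces the index type `Fin ∣ S ∣` by `Fin k`, so that columns can be
-- indexed by `Fin (m * n)` without transport.
enumerateAs : (S : Subset n) → ∣ S ∣ ≡ k → Enumeration S k
enumerateAs S refl = enumerate S

module Singleton (S : Subset n) (∣S∣≡1 : ∣ S ∣ ≡ 1) where

  private
    E = enumerateAs S ∣S∣≡1

  element : Fin n
  element = at E zero

  element∈ : element ∈ S
  element∈ = at∈ E zero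

  unique : ∀ {x y} → x ∈ S → y ∈ S → x ≡ y
  unique x∈S y∈S with surj E x∈S | surj E y∈S
  ... | zero , refl | zero , refl = refl

  sum-at-element : ∀ f → sum (λ x → 𝟙 S x * f x) ≡ f element
  sum-at-element f = trans (sym (sum-at E f)) (+-identityʳ _)

  sum-at-∈ : ∀ {x} → x ∈ S → ∀ f → sum (λ x → 𝟙 S x * f x) ≡ f x
  sum-at-∈ x∈S f = trans (sum-at-element f) (cong f (unique element∈ x∈S))

-- If there were two positions in the enumeration, `unique` would identify their elements, against
-- injectivity.
∣S∣≤1 : (S : Subset n) → (∀ {x y} → x ∈ S → y ∈ S → x ≡ y) → ∣ S ∣ ≤ 1
∣S∣≤1 S unique with ∣ S ∣ | enumerate S
... | zero        | _ = z≤n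
... | suc zero    | _ = ≤-refl
... | suc (suc _) | E = contradiction
  (inj E zero (suc zero) (unique (at∈ E zero) (at∈ E (suc zero)))) 0≢1+n

-- Fibres and incidence counts.

sum-fibre : (f : Fin n → Fin m) (x : Fin n) → sum (λ y → 𝟙 (fibre f y) x) ≡ 1
sum-fibre f x = trans (sum-cong-≗ λ y → 𝟙-tabulate (λ x → f x ≟ y) x) (sum-δ (f x))
  where
  sum-δ : ∀ {m} (z : Fin m) → sum (λ y → if does (z ≟ y) then 1 else 0) ≡ 1
  sum-δ {suc m} zero    = cong suc (sum-0 {m})
  sum-δ {suc m} (suc z) = sum-δ z

𝟙-blocksThrough : (B : Blocks v b) (p : Fin v) (j : Fin b) →
                  𝟙 (blocksThrough B p) j ≡ incidence B p j
𝟙-blocksThrough B p = 𝟙-tabulate (λ j → p ∈? B j)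

sum-incidence : (B : Blocks v b) (p : Fin v) → sum (incidence B p) ≡ ∣ blocksThrough B p ∣
sum-incidence B p =
  trans (sum-cong-≗ (sym ∘ 𝟙-blocksThrough B p)) (sum-𝟙 (blocksThrough B p))

sum-joint : (B : Blocks v b) (p p′ : Fin v) →
            sum (λ j → incidence B p j * incidence B p′ j) ≡ jointBlocks B p p′
sum-joint B p p′ = trans
  (sum-cong-≗ λ j → sym (cong₂ _*_ (𝟙-blocksThrough B p j) (𝟙-blocksThrough B p′ j)))
  (sum-𝟙*𝟙 (blocksThrough B p) (blocksThrough B p′))

-- Zero-one matrices as incidence matrices of BIBDs.

x*y≡0⇒x+y≤1 : ∀ {x y} → x ≤ 1 → y ≤ 1 → x * y ≡ 0 → x + y ≤ 1
x*y≡0⇒x+y≤1 {zero}         _   y≤1 _ = y≤1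
x*y≡0⇒x+y≤1 {suc x} {zero} x≤1 _ _ = subst (_≤ 1) (sym (+-identityʳ (suc x))) x≤1

support : Matrix v b → Blocks v b
support M j = tabulate λ i → does (M i j ℕ.≟ 1)

-- A matrix with entries at most 1 is the incidence matrix of its `support`, so block sizes,
-- replication numbers and joint counts become column sums, row sums and inner products of rows.
isBIBDMatrix : (M : Matrix v b) →
  (∀ i j → M i j ≤ 1) →
  (∀ j → sum (λ i → M i j) ≡ k) →
  (∀ i → sum (M i) ≡ r) →
  (∀ i i′ → i ≢ i′ → sum (λ j → M i j * M i′ j) ≡ ƛ) →
  IsBIBDMatrix v b r k ƛ M
isBIBDMatrix M M≤1 columns rows products = support M , record
  { isBD = record
    { blockSize = λ j → trans (sym (sum-𝟙 (support M j)))
        (trans (sum-cong-≗ λ i → sym (M≐ i j)) (columns j))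
    ; replication = λ i → trans (sym (sum-incidence (support M) i))
        (trans (sum-cong-≗ λ j → sym (M≐ i j)) (rows i))
    }
  ; balance = λ i i′ i≢i′ → trans (sym (sum-joint (support M) i i′))
      (trans (sum-cong-≗ λ j → sym (cong₂ _*_ (M≐ i j) (M≐ i′ j))) (products i i′ i≢i′))
  } , M≐
  where
  zero-one : ∀ x → x ≤ 1 → x ≡ (if does (x ℕ.≟ 1) then 1 else 0)
  zero-one zero          _ = refl
  zero-one (suc zero)    _ = refl
  zero-one (suc (suc _)) (s≤s ())

  M≐ : M ≐ incidence (support M)
  M≐ i j = trans (zero-one (M i j) (M≤1 i j))
    (sym (𝟙-tabulate (λ i → M i j ℕ.≟ 1) i))

-- Parameters and the chosen resolution set.

module Construction (m n l : ℕ)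
  (A : ARSRGD (suc m) n (suc m * n) (suc m * n) (suc m) (suc m) 0 (suc l)) where

  open ARSRGD A renaming (blocks to B)
  open IsGroupDivisible isGroupDivisible
  open IsBD isBD
  open IsSemiRegular isSemiRegular
  open IsAffineResolvable isAffineResolvable
  open IsResolution isResolution

  a : Matrix (suc m * n) (suc m * n)
  a = incidence B

  -- Semi-regularity reads r k = v λ₂ with r = k = `suc m` and v = `suc m * n`; one factor `suc m`
  -- cancels. Throughout, `suc m` is the number of groups and `suc l` is λ₂, so `m` is r* and `l` is
  -- λ*.
  1+m≡n*λ₂ : suc m ≡ n * suc l
  1+m≡n*λ₂ = *-cancelˡ-≡ (suc m) (n * suc l) (suc m) (trans r*k≡v*λ₂ (*-assoc (suc m) n (suc l)))

  q≡λ₂ : q ≡ suc l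
  q≡λ₂ = *-cancelʳ-≡ q (suc l) (suc m) (trans q*r≡k*λ₂ (*-comm (suc m) (suc l)))

  T : Subset (suc m * n)
  T = fibre res zero

  ∣T∣≡n : ∣ T ∣ ≡ n
  ∣T∣≡n = *-cancelʳ-≡ ∣ T ∣ n (suc m) (trans (size*r≡b zero) (*-comm (suc m) n))

  ∣∁T∣≡m*n : ∣ ∁ T ∣ ≡ m * n
  ∣∁T∣≡m*n = trans (∣∁p∣≡n∸∣p∣ T)
    -- `suc m * n` unfolds to `n + m * n`, from which the `n` blocks of `T` are removed.
    (trans (cong (suc m * n ∸_) ∣T∣≡n) (m+n∸m≡n n (m * n)))

  enumT : Enumeration T n
  enumT = enumerateAs T ∣T∣≡n

  enum∁T : Enumeration (∁ T) (m * n)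
  enum∁T = enumerateAs (∁ T) ∣∁T∣≡m*n

  C : Fin n → Fin (suc m * n)
  C = at enumT

  D : Fin (m * n) → Fin (suc m * n)
  D = at enum∁T

  -- One block is in `T` and the other is not, so they belong to different resolution sets and
  -- affine resolvability applies.
  C∩D : ∀ h j → ∣ B (C h) ∩ B (D j) ∣ ≡ suc l
  C∩D h j = trans (affine (C h) (D j) λ eq → x∈∁p⇒x∉p (at∈ enum∁T j)
    (∈-tabulate⁺ (λ x → res x ≟ zero)
      (trans (sym eq) (∈-tabulate⁻ (λ x → res x ≟ zero) (at∈ enumT h))))) q≡λ₂

  -- Blocks as transversals of the groups.

  sameGroup-disjoint : ∀ {p p′} → p ≢ p′ → group p ≡ group p′ → ∀ j → a p j * a p′ j ≡ 0
  sameGroup-disjoint {p} {p′} p≢p′ eq =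
    sum≡0⇒≡0 _ (trans (sum-joint B p p′) (sameGroup p p′ p≢p′ eq))

  cell : Fin (suc m * n) → Fin (suc m) → Subset (suc m * n)
  cell j g = B j ∩ fibre group g

  cell-group : ∀ {j g p} → p ∈ cell j g → group p ≡ g
  cell-group {j} {g} p∈ =
    ∈-tabulate⁻ (λ x → group x ≟ g) (proj₂ (x∈p∩q⁻ (B j) (fibre group g) p∈))

  cell-block : ∀ {j g p} → p ∈ cell j g → p ∈ B j
  cell-block {j} {g} p∈ = proj₁ (x∈p∩q⁻ (B j) (fibre group g) p∈)

  -- Two different points of one group on a common block would contribute 1 to a joint count that is
  -- λ₁ = 0.
  cell-unique : ∀ {j g p p′} → p ∈ cell j g → p′ ∈ cell j g → p ≡ p′
  cell-unique {j} {g} {p} {p′} p∈ p′∈ with p ≟ p′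
  ... | yes p≡p′ = p≡p′
  ... | no  p≢p′ = contradiction
    (trans (sym (cong₂ _*_ (𝟙-∈ (cell-block {j} {g} p∈)) (𝟙-∈ (cell-block {j} {g} p′∈))))
      (sameGroup-disjoint p≢p′ (trans (cell-group {j} p∈) (sym (cell-group {j} p′∈))) j))
    1+n≢0

  -- After exchanging the sums, each point is counted once because it lies in exactly one group.
  -- Constant `f` counts the points of a block; an incidence column as `f` counts an intersection.
  sum-cells : ∀ j (f : Fin (suc m * n) → ℕ) →
              sum (λ g → sum (λ p → 𝟙 (cell j g) p * f p)) ≡ sum (λ p → a p j * f p)
  sum-cells j f = trans (∑-comm (λ g p → 𝟙 (cell j g) p * f p)) (sum-cong-≗ λ p → begin
    sum (λ g → 𝟙 (cell j g) p * f p)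
      ≡⟨ sum-cong-≗ (λ g → trans (cong (_* f p) (𝟙-∩ (B j) (fibre group g) p))
                                 (shuffle (a p j) (𝟙 (fibre group g) p) (f p))) ⟩
    sum (λ g → a p j * f p * 𝟙 (fibre group g) p)
      ≡⟨ *-distribˡ-sum (a p j * f p) (λ g → 𝟙 (fibre group g) p) ⟨
    a p j * f p * sum (λ g → 𝟙 (fibre group g) p)
      ≡⟨ cong (a p j * f p *_) (sum-fibre group p) ⟩
    a p j * f p * 1
      ≡⟨ *-identityʳ _ ⟩
    a p j * f p ∎)
    where
    open ≡-Reasoning
    shuffle : ∀ x y z → x * y * z ≡ x * z * y
    shuffle = solve-∀

  -- The `suc m` cells of a block have at most one point each and together contain its k = `suc m`
  -- points.
  ∣cell∣≡1 : ∀ j g → ∣ cell j g ∣ ≡ 1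
  ∣cell∣≡1 j = sum≡n⇒≡1 (λ g → ∣ cell j g ∣)
    (λ g → ∣S∣≤1 (cell j g) (cell-unique {j} {g})) (begin
    sum (λ g → ∣ cell j g ∣)
      ≡⟨ sum-cong-≗ (λ g → trans (sum-*1 (𝟙 (cell j g))) (sum-𝟙 (cell j g))) ⟨
    sum (λ g → sum (λ p → 𝟙 (cell j g) p * 1))
      ≡⟨ sum-cells j (λ _ → 1) ⟩
    sum (λ p → a p j * 1)
      ≡⟨ sum-*1 (λ p → a p j) ⟩
    sum (λ p → a p j)
      ≡⟨ sum-𝟙 (B j) ⟩
    ∣ B j ∣
      ≡⟨ blockSize j ⟩
    suc m ∎)
    where open ≡-Reasoning

  module Cell (h : Fin n) (g : Fin (suc m)) = Singleton (cell (C h) g) (∣cell∣≡1 (C h) g)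

  point : Fin n → Fin (suc m) → Fin (suc m * n)
  point h g = Cell.element h g

  point∈C : ∀ h g → point h g ∈ B (C h)
  point∈C h g = cell-block {C h} {g} (Cell.element∈ h g)

  group-point : ∀ h g → group (point h g) ≡ g
  group-point h g = cell-group {C h} {g} (Cell.element∈ h g)

  module Once (p : Fin (suc m * n)) = Singleton (blocksThrough B p ∩ T) (once zero p)

  through-C : ∀ {p} h → p ∈ B (C h) → C h ∈ blocksThrough B p ∩ T
  through-C {p} h p∈ = x∈p∩q⁺ (∈-tabulate⁺ (λ j → p ∈? B j) p∈ , at∈ enumT h)

  -- A resolution set covers each point only once, and the point is already on `C h`.
  point∉C : ∀ {h h′} → h ≢ h′ → ∀ g → point h g ∉ B (C h′)
  point∉C {h} {h′} h≢h′ g p∈C′ = h≢h′ (inj enumT h h′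
    (Once.unique (point h g) (through-C h (point∈C h g)) (through-C h′ p∈C′)))

  -- The matrices and their row and column counts.

  N : Fin n → Matrix (suc m) (m * n)
  N h g j = a (point h g) (D j)

  sum-T : ∀ h g f → sum (λ j → 𝟙 T j * (a (point h g) j * f j)) ≡ f (C h)
  sum-T h g f = trans
    (sum-cong-≗ λ j → begin
      𝟙 T j * (a p j * f j)                ≡⟨ shuffle (𝟙 T j) (a p j) (f j) ⟩
      a p j * 𝟙 T j * f j                  ≡⟨ cong (λ x → x * 𝟙 T j * f j) (𝟙-blocksThrough B p j) ⟨
      𝟙 (blocksThrough B p) j * 𝟙 T j * f j ≡⟨ cong (_* f j) (𝟙-∩ (blocksThrough B p) T j) ⟨
      𝟙 (blocksThrough B p ∩ T) j * f j    ∎)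
    (Once.sum-at-∈ p (through-C h (point∈C h g)) f)
    where
    open ≡-Reasoning
    p = point h g
    shuffle : ∀ x y z → x * (y * z) ≡ y * x * z
    shuffle = solve-∀

  -- Among the blocks of `T` only `C h` passes through the point, so `T` contributes the single term
  -- `f (C h)`. Row sums come from `f` = 1, inner products from `f` an incidence row.
  sum-D : ∀ h g f →
          sum (λ j → a (point h g) j * f j) ≡ f (C h) + sum (λ j → N h g j * f (D j))
  sum-D h g f = trans (sum-split T _)
    (cong₂ _+_ (sum-T h g f) (sym (sum-at enum∁T (λ j → a (point h g) j * f j))))

  columns : ∀ h j → sum (λ g → N h g j) ≡ suc l
  columns h j = begin
    sum (λ g → a (point h g) (D j))
      ≡⟨ sum-cong-≗ (λ g → Cell.sum-at-element h g (λ p → a p (D j))) ⟨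
    sum (λ g → sum (λ p → 𝟙 (cell (C h) g) p * a p (D j)))
      ≡⟨ sum-cells (C h) (λ p → a p (D j)) ⟩
    sum (λ p → a p (C h) * a p (D j))
      ≡⟨ sum-𝟙*𝟙 (B (C h)) (B (D j)) ⟩
    ∣ B (C h) ∩ B (D j) ∣
      ≡⟨ C∩D h j ⟩
    suc l ∎
    where open ≡-Reasoning

  rows : ∀ h g → sum (N h g) ≡ m
  rows h g = +-cancelˡ-≡ 1 _ _ (begin
    1 + sum (N h g)
      ≡⟨ cong suc (sum-*1 (N h g)) ⟨
    1 + sum (λ j → N h g j * 1)
      ≡⟨ sum-D h g (λ _ → 1) ⟨
    sum (λ j → a (point h g) j * 1)
      ≡⟨ sum-*1 (a (point h g)) ⟩
    sum (a (point h g))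
      ≡⟨ sum-incidence B (point h g) ⟩
    ∣ blocksThrough B (point h g) ∣
      ≡⟨ replication (point h g) ⟩
    suc m ∎)
    where open ≡-Reasoning

  -- The two points lie in different groups and share λ₂ blocks. The first summand is the share of
  -- `T`: it is 1 if `h` and `h′` agree and 0 otherwise, which separates `products` from
  -- `cross-products`.
  joint : ∀ h h′ {g g′} → g ≢ g′ →
          a (point h′ g′) (C h) + sum (λ j → N h g j * N h′ g′ j) ≡ suc l
  joint h h′ {g} {g′} g≢g′ = begin
    a (point h′ g′) (C h) + sum (λ j → N h g j * N h′ g′ j)
      ≡⟨ sum-D h g (a (point h′ g′)) ⟨
    sum (λ j → a (point h g) j * a (point h′ g′) j)
      ≡⟨ sum-joint B (point h g) (point h′ g′) ⟩
    jointBlocks B (point h g) (point h′ g′)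
      ≡⟨ differentGroup _ _ (λ eq → g≢g′
           (trans (sym (group-point h g)) (trans eq (group-point h′ g′)))) ⟩
    suc l ∎
    where open ≡-Reasoning

  products : ∀ h {g g′} → g ≢ g′ → sum (λ j → N h g j * N h g′ j) ≡ l
  products h {g} {g′} g≢g′ = +-cancelˡ-≡ 1 _ _
    (trans (cong (_+ sum (λ j → N h g j * N h g′ j)) (sym (𝟙-∈ (point∈C h g′)))) (joint h h g≢g′))

  cross-products : ∀ {h h′} → h ≢ h′ → ∀ {g g′} → g ≢ g′ →
                   sum (λ j → N h g j * N h′ g′ j) ≡ suc l
  cross-products {h} {h′} h≢h′ {g} {g′} g≢g′ =
    trans (cong (_+ sum (λ j → N h g j * N h′ g′ j)) (sym (𝟙-∉ (point∉C (h≢h′ ∘ sym) g′))))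
      (joint h h′ g≢g′)

  N≤1 : ∀ h g j → N h g j ≤ 1
  N≤1 h g j = 𝟙≤1 (B (D j)) (point h g)

  -- Different blocks of `T` meet group `g` in different points, and by λ₁ = 0 these share no block.
  disjoint : ∀ {h h′} → h ≢ h′ → ∀ g j → N h g j * N h′ g j ≡ 0
  disjoint {h} {h′} h≢h′ g j = sameGroup-disjoint
    (λ eq → point∉C h≢h′ g (subst (_∈ B (C h′)) (sym eq) (point∈C h′ g)))
    (trans (group-point h g) (sym (group-point h′ g))) (D j)

  -- If the matrices were equal, disjointness would make the square of every entry 0, against the
  -- positive row sum `m`.
  distinct : 1 ≤ m → ∀ {h h′} → h ≢ h′ → ¬ (N h ≐ N h′)
  distinct 1≤m {h} {h′} h≢h′ eq = contradiction (subst (1 ≤_) m≡0 1≤m) λ ()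
    where
    N≡0 : ∀ j → N h zero j ≡ 0
    N≡0 j = [ id , id ]′ (m*n≡0⇒m≡0∨n≡0 (N h zero j)
      (trans (cong (N h zero j *_) (eq zero j)) (disjoint h≢h′ zero j)))

    m≡0 : m ≡ 0
    m≡0 = begin
      m                              ≡⟨ rows h zero ⟨
      sum (N h zero)                 ≡⟨ sum-cong-≗ N≡0 ⟩
      sum {m * n} (λ _ → 0)          ≡⟨ sum-0 {m * n} ⟩
      0                              ∎
      where open ≡-Reasoning

  -- Sums of two matrices and the full PAB.

  double : ∀ x → x + x ≡ 2 * x
  double = solve-∀

  -- Expanding gives four inner products: the two within one matrix equal λ₂ - 1, the two mixed ones
  -- equal λ₂.
  sum-products : ∀ {h h′} → h ≢ h′ → ∀ g g′ → g ≢ g′ →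
                 sum (λ j → (N h g j + N h′ g j) * (N h g′ j + N h′ g′ j)) ≡ 2 * (2 * suc l ∸ 1)
  sum-products {h} {h′} h≢h′ g g′ g≢g′ = begin
    sum (λ j → (N h g j + N h′ g j) * (N h g′ j + N h′ g′ j))
      ≡⟨ sum-cong-≗ (λ j → expand (N h g j) (N h′ g j) (N h g′ j) (N h′ g′ j)) ⟩
    sum (λ j → (P h h j + P h h′ j) + (P h′ h j + P h′ h′ j))
      ≡⟨ ∑-distrib-+ (λ j → P h h j + P h h′ j) (λ j → P h′ h j + P h′ h′ j) ⟩
    sum (λ j → P h h j + P h h′ j) + sum (λ j → P h′ h j + P h′ h′ j)
      ≡⟨ cong₂ _+_ (∑-distrib-+ (P h h) (P h h′)) (∑-distrib-+ (P h′ h) (P h′ h′)) ⟩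
    (sum (P h h) + sum (P h h′)) + (sum (P h′ h) + sum (P h′ h′))
      ≡⟨ cong₂ _+_ (cong₂ _+_ (products h g≢g′) (cross-products h≢h′ g≢g′))
                   (cong₂ _+_ (cross-products (h≢h′ ∘ sym) g≢g′) (products h′ g≢g′)) ⟩
    (l + suc l) + (suc l + l)
      ≡⟨ total l ⟩
    -- The second factor is the normal form of `2 * suc l ∸ 1`.
    2 * (l + (suc l + 0)) ∎
    where
    open ≡-Reasoning
    P : Fin n → Fin n → Fin (m * n) → ℕ
    P h₁ h₂ j = N h₁ g j * N h₂ g′ j
    expand : ∀ w x y z → (w + x) * (y + z) ≡ (w * y + w * z) + (x * y + x * z)
    expand = solve-∀
    total : ∀ l → (l + suc l) + (suc l + l) ≡ 2 * (l + (suc l + 0))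
    total = solve-∀

  fullPAB : 1 ≤ m → FullPAB (suc m) (m * n) m (suc l) l
  fullPAB 1≤m = record
    { ℓ        = n
    ; matrices = N
    ; isPAB    = record
      { 1<v      = s≤s 1≤m
      ; distinct = λ _ _ → distinct 1≤m
      ; isBIBD   = λ h → isBIBDMatrix (N h) (N≤1 h) (columns h) (rows h)
                     λ _ _ → products h
      ; disjoint = λ _ _ → disjoint
      -- Since r* = v* - 1 = `m`, the quotient 2r*(2k* - 1)/(v* - 1) is 2(2k* - 1).
      ; sumBIBD  = λ h h′ h≢h′ → 2 * (2 * suc l ∸ 1) , exact m (2 * suc l ∸ 1) ,
          isBIBDMatrix (N h ⊕ N h′)
            (λ g j → x*y≡0⇒x+y≤1 (N≤1 h g j) (N≤1 h′ g j) (disjoint h≢h′ g j))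
            (λ j → trans (∑-distrib-+ (λ g → N h g j) (λ g → N h′ g j))
                     (trans (cong₂ _+_ (columns h j) (columns h′ j)) (double (suc l))))
            (λ g → trans (∑-distrib-+ (N h g) (N h′ g))
                     (trans (cong₂ _+_ (rows h g) (rows h′ g)) (double m)))
            (sum-products h≢h′)
      }
    ; 0<k      = s≤s z≤n
    ; ℓ*k≡v    = sym 1+m≡n*λ₂
    }
    where
    exact : ∀ m x → 2 * x * m ≡ 2 * m * x
    exact = solve-∀

theorem3p1 : (m n λ₂ : ℕ) → 2 ≤ m → 2 ≤ n → 1 ≤ λ₂ →
    ARSRGD m n (m * n) (m * n) m m 0 λ₂ →
    (m ≡ n * λ₂) × FullPAB m ((m ∸ 1) * n) (m ∸ 1) λ₂ (λ₂ ∸ 1)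
-- Matching on successors makes `m ∸ 1` and `λ₂ ∸ 1` reduce to the predecessors used in
-- `Construction`; 2 ≤ `suc m` leaves the bound 1 ≤ `m`.
theorem3p1 (suc m) n (suc l) (s≤s 1≤m) _ (s≤s _) A = 1+m≡n*λ₂ , fullPAB 1≤m
  where open Construction m n l A
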